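{- Let $0\leq m\leq n$ be integers, let $k=\min(m,n-m)$, let $r\in\{1,\ldots,k\}$, and set $j=n-k+r-1$. For $S\in\binom{[j]}{r-1}$ and $t\in[j+1]$ define $$F(S,t)=\begin{cases} S\cup\{t\}, & t\notin S,\\ S\cup\{j\}, & t\in S.\end{cases}$$ Then the map $$\Phi_{j,r}:\binom{[j]}{r-1}\times[j+1]\longrightarrow\binom{[j+1]}{r}\times[r],\qquad (S,t)\longmapsto\bigl(F(S,t),\operatorname{rank}_{F(S,t)}(t)\bigr)$$ is a bijection.
   Context: For a nonnegative integer $N$, $[N]=\{0,1,\ldots,N-1\}$, and $\binom{[N]}{k}$ denotes the family of all $k$-element subsets of $[N]$. For a finite set $A$ of integers and $x\in A$, $\operatorname{rank}_A(x)=|\{y\in A: y<x\}|$ is the zero-based rank of $x$ in $A$. -}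

module Defs where

open import Data.Bool.Base using (if_then_else_)
open import Data.Fin.Base using (Fin; fromℕ; fromℕ<)
open import Data.Fin.Properties using (_<?_)
open import Data.Fin.Subset using (Subset; outside; ⁅_⁆; _∩_; _∪_; ∣_∣)
open import Data.Fin.Subset.Properties using (_∈?_)
open import Data.Nat.Base using (ℕ; suc; _∸_; _<_)
open import Data.Product.Base using (Σ-syntax; _×_; _,_; proj₁; proj₂)
open import Data.Vec.Base using (_∷ʳ_; tabulate)
open import Relation.Binary.PropositionalEquality.Core using (_≡_)
open import Relation.Nullary.Decidable.Core using (does)

-- Equality of cardinalities in ℕ is proof irrelevant, so _≡_ on this type is
-- equality of the underlying subsets.
KSubset : ℕ → ℕ → Set
KSubset N k = Σ[ A ∈ Subset N ] ∣ A ∣ ≡ k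

below : ∀ {N} → Fin N → Subset N
below x = tabulate (λ y → does (y <? x))

-- Meaningful for x ∈ A; the formula does not depend on that membership.
rank : ∀ {N} → Subset N → Fin N → ℕ
rank A x = ∣ A ∩ below x ∣

-- A subset of {0,…,j-1} regarded as a subset of {0,…,j}: the same elements,
-- with the new last element j left out.
widen : ∀ {j} → Subset j → Subset (suc j)
widen S = S ∷ʳ outside

F : ∀ {j} → Subset j → Fin (suc j) → Subset (suc j)
F {j} S t =
  if does (t ∈? widen S)
  then widen S ∪ ⁅ fromℕ j ⁆
  else widen S ∪ ⁅ t ⁆

-- The values of (S , t) ↦ (F S t , rank (F S t) t) lie in the codomain of Φ.
WellDefined : ℕ → ℕ → Set
WellDefined j r = (S : KSubset j (r ∸ 1)) (t : Fin (suc j)) →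
  ∣ F (proj₁ S) t ∣ ≡ r × rank (F (proj₁ S) t) t < r

Φ : ∀ {j r} → WellDefined j r →
    KSubset j (r ∸ 1) × Fin (suc j) → KSubset (suc j) r × Fin r
Φ wd (S , t) =
  (F (proj₁ S) t , proj₁ (wd S t)) , fromℕ< (proj₂ (wd S t))

{-# OPTIONS --safe #-}
module Submission where

-- Let G = F(S,t); then t ∈ G, and an element of G is determined by its rank, so
-- it remains to recover S from G and t ∈ G.  If j ∈ G, then S = G ∖ {j}: this
-- covers both t ∈ S and t = j.  If j ∉ G, then S = G ∖ {t}.

open import Defs
open import Data.Bool.Properties using (∨-identityʳ)
open import Data.Fin.Base using (Fin; zero; suc; fromℕ; inject₁; toℕ)
open import Data.Fin.Properties using (fromℕ<-injective; toℕ-fromℕ<; toℕ-injective; toℕ<n)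
open import Data.Fin.Relation.Unary.Top using (view; ‵fromℕ; ‵inject₁)
open import Data.Fin.Subset
  using (Subset; inside; outside; ⊥; ⁅_⁆; _∈_; _∉_; _∩_; _∪_; _-_; ∣_∣)
open import Data.Fin.Subset.Properties
  using (_∈?_; ∣⊥∣≡0; ∩-zeroʳ; ∪-identityʳ; p─⊥≡p; x∈⁅x⁆; x∈p∪q⁺; drop-not-there)
open import Data.Nat.Base using (ℕ; zero; suc; _+_; _∸_; _⊓_; _≤_; _<_; z<s; s<s; s<s⁻¹)
open import Data.Nat.Properties using (suc-injective; ≡-irrelevant)
open import Data.Product.Base using (Σ-syntax; ∃-syntax; _×_; _,_; proj₁; proj₂)
open import Data.Sum.Base using (inj₂)
open import Data.Vec.Base using ([]; _∷_; _∷ʳ_; here; there; tabulate; initLast)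
open import Data.Vec.Properties using (∷ʳ-injectiveˡ; ∷ʳ-injectiveʳ)
open import Function.Base using (_∘_)
open import Function.Consequences.Propositional using (strictlySurjective⇒surjective)
open import Function.Definitions using (Bijective; Injective; StrictlySurjective)
open import Relation.Binary.PropositionalEquality.Core
  using (_≡_; refl; sym; trans; cong; cong₂; subst)
open import Relation.Binary.PropositionalEquality.Properties using (module ≡-Reasoning)
open import Relation.Nullary.Decidable using (yes; no; dec-true; dec-false)
open import Relation.Nullary.Negation.Core using (contradiction)

x∉p⇒∣p∪⁅x⁆∣≡1+∣p∣ : ∀ {n} {p : Subset n} {x} → x ∉ p → ∣ p ∪ ⁅ x ⁆ ∣ ≡ suc ∣ p ∣
x∉p⇒∣p∪⁅x⁆∣≡1+∣p∣ {p = inside  ∷ p} {zero}  x∉p = contradiction here x∉p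
x∉p⇒∣p∪⁅x⁆∣≡1+∣p∣ {p = outside ∷ p} {zero}  x∉p = cong (suc ∘ ∣_∣) (∪-identityʳ p)
x∉p⇒∣p∪⁅x⁆∣≡1+∣p∣ {p = inside  ∷ p} {suc x} x∉p = cong suc (x∉p⇒∣p∪⁅x⁆∣≡1+∣p∣ (drop-not-there x∉p))
x∉p⇒∣p∪⁅x⁆∣≡1+∣p∣ {p = outside ∷ p} {suc x} x∉p = x∉p⇒∣p∪⁅x⁆∣≡1+∣p∣ (drop-not-there x∉p)

-- With the next lemma this makes insertion and deletion of a fixed `x` inverse to each other. This
-- direction serves injectivity of `F` in `S` for a new `t`; the other one serves surjectivity.
x∉p⇒p∪⁅x⁆-x≡p : ∀ {n} {p : Subset n} {x} → x ∉ p → p ∪ ⁅ x ⁆ - x ≡ p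
x∉p⇒p∪⁅x⁆-x≡p {p = inside  ∷ p} {zero}  x∉p = contradiction here x∉p
x∉p⇒p∪⁅x⁆-x≡p {p = outside ∷ p} {zero}  x∉p = cong (outside ∷_) (trans (p─⊥≡p _) (∪-identityʳ p))
x∉p⇒p∪⁅x⁆-x≡p {p = s ∷ p}       {suc x} x∉p = cong₂ _∷_ (∨-identityʳ s) (x∉p⇒p∪⁅x⁆-x≡p (drop-not-there x∉p))

x∈p⇒[p-x]∪⁅x⁆≡p : ∀ {n} {p : Subset n} {x} → x ∈ p → (p - x) ∪ ⁅ x ⁆ ≡ p
x∈p⇒[p-x]∪⁅x⁆≡p {p = _ ∷ p} here        = cong (inside ∷_) (trans (∪-identityʳ _) (p─⊥≡p p))
x∈p⇒[p-x]∪⁅x⁆≡p {p = s ∷ p} (there x∈p) = cong₂ _∷_ (∨-identityʳ s) (x∈p⇒[p-x]∪⁅x⁆≡p x∈p)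

x∉p-x : ∀ {n} (p : Subset n) x → x ∉ p - x
x∉p-x (_ ∷ p) zero    ()
x∉p-x (_ ∷ p) (suc x) (there x∈p-x) = x∉p-x p x x∈p-x

∣p∷ʳoutside∣≡∣p∣ : ∀ {n} (p : Subset n) → ∣ p ∷ʳ outside ∣ ≡ ∣ p ∣
∣p∷ʳoutside∣≡∣p∣ []            = refl
∣p∷ʳoutside∣≡∣p∣ (inside  ∷ p) = cong suc (∣p∷ʳoutside∣≡∣p∣ p)
∣p∷ʳoutside∣≡∣p∣ (outside ∷ p) = ∣p∷ʳoutside∣≡∣p∣ p

∣p∷ʳinside∣≡1+∣p∣ : ∀ {n} (p : Subset n) → ∣ p ∷ʳ inside ∣ ≡ suc ∣ p ∣
∣p∷ʳinside∣≡1+∣p∣ []            = refl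
∣p∷ʳinside∣≡1+∣p∣ (inside  ∷ p) = cong suc (∣p∷ʳinside∣≡1+∣p∣ p)
∣p∷ʳinside∣≡1+∣p∣ (outside ∷ p) = ∣p∷ʳinside∣≡1+∣p∣ p

inject₁-∈⁺ : ∀ {n} {p : Subset n} {x} s → x ∈ p → inject₁ x ∈ p ∷ʳ s
inject₁-∈⁺ s here        = here
inject₁-∈⁺ s (there x∈p) = there (inject₁-∈⁺ s x∈p)

inject₁-∈⁻ : ∀ {n} (p : Subset n) x s → inject₁ x ∈ p ∷ʳ s → x ∈ p
inject₁-∈⁻ (_ ∷ p) zero    s here        = here
inject₁-∈⁻ (_ ∷ p) (suc x) s (there x∈p) = there (inject₁-∈⁻ p x s x∈p)

fromℕ∈p∷ʳinside : ∀ {n} (p : Subset n) → fromℕ n ∈ p ∷ʳ inside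
fromℕ∈p∷ʳinside []      = here
fromℕ∈p∷ʳinside (_ ∷ p) = there (fromℕ∈p∷ʳinside p)

fromℕ∉widen : ∀ {n} (p : Subset n) → fromℕ n ∉ widen p
fromℕ∉widen []      ()
fromℕ∉widen (_ ∷ p) (there n∈p) = fromℕ∉widen p n∈p

widen-∪-⁅fromℕ⁆ : ∀ {n} (p : Subset n) → widen p ∪ ⁅ fromℕ n ⁆ ≡ p ∷ʳ inside
widen-∪-⁅fromℕ⁆ []      = refl
widen-∪-⁅fromℕ⁆ (s ∷ p) = cong₂ _∷_ (∨-identityʳ s) (widen-∪-⁅fromℕ⁆ p)

widen-∪-⁅inject₁⁆ : ∀ {n} (p : Subset n) x → widen p ∪ ⁅ inject₁ x ⁆ ≡ widen (p ∪ ⁅ x ⁆)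
widen-∪-⁅inject₁⁆ (s ∷ p) zero    = cong (_ ∷_) (trans (∪-identityʳ _) (cong widen (sym (∪-identityʳ p))))
widen-∪-⁅inject₁⁆ (s ∷ p) (suc x) = cong (_ ∷_) (widen-∪-⁅inject₁⁆ p x)

below-zero : ∀ {n} → below (zero {n}) ≡ ⊥
below-zero {n} = cong (outside ∷_) (tabulate-outside n)
  where
  tabulate-outside : ∀ n → tabulate {n = n} (λ _ → outside) ≡ ⊥
  tabulate-outside zero    = refl
  tabulate-outside (suc n) = cong (outside ∷_) (tabulate-outside n)

rank-zero : ∀ {n} (A : Subset (suc n)) → rank A zero ≡ 0
rank-zero {n} A = trans (cong (λ B → ∣ A ∩ B ∣) below-zero) (trans (cong ∣_∣ (∩-zeroʳ A)) (∣⊥∣≡0 (suc n)))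

-- Here and in the next two lemmas, `below (suc x)` computes to `inside ∷ below x`. Hence the rank
-- of `suc x` in `s ∷ A` is the rank of `x` in `A`, plus one exactly when `s` is `inside`, and
-- induction along the vector applies.
rank<∣A∣ : ∀ {n} {A : Subset n} {x} → x ∈ A → rank A x < ∣ A ∣
rank<∣A∣ {A = A}           here        = subst (_< ∣ A ∣) (sym (rank-zero A)) z<s
rank<∣A∣ {A = inside  ∷ A} (there x∈A) = s<s (rank<∣A∣ x∈A)
rank<∣A∣ {A = outside ∷ A} (there x∈A) = rank<∣A∣ x∈A

rank-injective : ∀ {n} {A : Subset n} {x y} → x ∈ A → y ∈ A → rank A x ≡ rank A y → x ≡ y
rank-injective {A = A} here here _ = refl
-- `here` forces the head of `A` to be `inside`, so `zero` is counted below the other element, whose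
-- rank is then a successor.
rank-injective {A = A} here (there _) eq = contradiction (trans (sym (rank-zero A)) eq) λ ()
rank-injective {A = A} (there _) here eq = contradiction (trans (sym (rank-zero A)) (sym eq)) λ ()
rank-injective {A = inside  ∷ A} (there x∈A) (there y∈A) eq = cong suc (rank-injective x∈A y∈A (suc-injective eq))
rank-injective {A = outside ∷ A} (there x∈A) (there y∈A) eq = cong suc (rank-injective x∈A y∈A eq)

rank-surjective : ∀ {n} (A : Subset n) {i} → i < ∣ A ∣ → ∃[ x ] x ∈ A × rank A x ≡ i
rank-surjective (inside  ∷ A) {zero}  _   = zero , here , rank-zero (inside ∷ A)
rank-surjective (inside  ∷ A) {suc i} i<∣A∣ with x , x∈A , eq ← rank-surjective A (s<s⁻¹ i<∣A∣) =
  suc x , there x∈A , cong suc eq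
rank-surjective (outside ∷ A) i<∣A∣ with x , x∈A , eq ← rank-surjective A i<∣A∣ =
  suc x , there x∈A , eq

-- S ∷ʳ inside is S ∪ {j}, so the hypothesis reads: t ∈ S or t = j.
F-∈ : ∀ {j} (S : Subset j) {t} → t ∈ S ∷ʳ inside → F S t ≡ S ∷ʳ inside
F-∈ S {t} t∈ with view t
... | ‵fromℕ     rewrite dec-false (fromℕ _ ∈? widen S) (fromℕ∉widen S) = widen-∪-⁅fromℕ⁆ S
... | ‵inject₁ u rewrite dec-true (inject₁ u ∈? widen S) (inject₁-∈⁺ outside (inject₁-∈⁻ S u inside t∈)) =
  widen-∪-⁅fromℕ⁆ S

F-∉ : ∀ {j} (S : Subset j) {u} → u ∉ S → F S (inject₁ u) ≡ widen (S ∪ ⁅ u ⁆)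
F-∉ S {u} u∉S rewrite dec-false (inject₁ u ∈? widen S) (u∉S ∘ inject₁-∈⁻ S u outside) = widen-∪-⁅inject₁⁆ S u

-- The cases follow the value of `F`, not the test in its definition: `t = j` takes the `else`
-- branch, but the result is `S ∷ʳ inside`, just as for `t ∈ S`.
data Position {j} (S : Subset j) : Fin (suc j) → Set where
  in-S∪⁅j⁆ : ∀ {t} → t ∈ S ∷ʳ inside → Position S t
  new      : ∀ {u} → u ∉ S → Position S (inject₁ u)

position : ∀ {j} (S : Subset j) t → Position S t
position S t with view t
... | ‵fromℕ = in-S∪⁅j⁆ (fromℕ∈p∷ʳinside S)
... | ‵inject₁ u with u ∈? S
...   | yes u∈S = in-S∪⁅j⁆ (inject₁-∈⁺ inside u∈S)
...   | no  u∉S = new u∉S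

-- In both positions exactly one element outside `S` is adjoined: `j` in the first, `u` in the
-- second.
∣F∣≡1+∣S∣ : ∀ {j} (S : Subset j) t → ∣ F S t ∣ ≡ suc ∣ S ∣
∣F∣≡1+∣S∣ S t with position S t
... | in-S∪⁅j⁆ t∈ = trans (cong ∣_∣ (F-∈ S t∈)) (∣p∷ʳinside∣≡1+∣p∣ S)
... | new {u} u∉S = begin
  ∣ F S (inject₁ u) ∣    ≡⟨ cong ∣_∣ (F-∉ S u∉S) ⟩
  ∣ widen (S ∪ ⁅ u ⁆) ∣  ≡⟨ ∣p∷ʳoutside∣≡∣p∣ (S ∪ ⁅ u ⁆) ⟩
  ∣ S ∪ ⁅ u ⁆ ∣          ≡⟨ x∉p⇒∣p∪⁅x⁆∣≡1+∣p∣ u∉S ⟩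
  suc ∣ S ∣              ∎
  where open ≡-Reasoning

-- The bound on ranks and their injectivity hold only for members, so this is what lets them be
-- applied to `t` in `F S t`.
t∈F : ∀ {j} (S : Subset j) t → t ∈ F S t
t∈F S t with position S t
... | in-S∪⁅j⁆ t∈ = subst (t ∈_) (sym (F-∈ S t∈)) t∈
... | new {u} u∉S = subst (t ∈_) (sym (F-∉ S u∉S)) (inject₁-∈⁺ outside (x∈p∪q⁺ (inj₂ (x∈⁅x⁆ u))))

F-injectiveˡ : ∀ {j} (S S′ : Subset j) t → F S t ≡ F S′ t → S ≡ S′
F-injectiveˡ S S′ t eq with view t
... | ‵fromℕ =
  ∷ʳ-injectiveˡ S S′ (trans (sym (F-∈ S (fromℕ∈p∷ʳinside S))) (trans eq (F-∈ S′ (fromℕ∈p∷ʳinside S′))))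
... | ‵inject₁ u with u ∈? S | u ∈? S′
...   | yes u∈S | yes u∈S′ = ∷ʳ-injectiveˡ S S′
  (trans (sym (F-∈ S (inject₁-∈⁺ inside u∈S))) (trans eq (F-∈ S′ (inject₁-∈⁺ inside u∈S′))))
-- The mixed cases cannot occur: one side contains `j` and the other does not, so the last entries
-- differ.
...   | yes u∈S | no u∉S′ = contradiction
  (∷ʳ-injectiveʳ S (S′ ∪ ⁅ u ⁆) (trans (sym (F-∈ S (inject₁-∈⁺ inside u∈S))) (trans eq (F-∉ S′ u∉S′)))) λ ()
...   | no u∉S | yes u∈S′ = contradiction
  (∷ʳ-injectiveʳ (S ∪ ⁅ u ⁆) S′ (trans (sym (F-∉ S u∉S)) (trans eq (F-∈ S′ (inject₁-∈⁺ inside u∈S′))))) λ ()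
...   | no u∉S | no u∉S′ = begin
  S                 ≡⟨ x∉p⇒p∪⁅x⁆-x≡p u∉S ⟨
  S ∪ ⁅ u ⁆ - u     ≡⟨ cong (_- u) (∷ʳ-injectiveˡ (S ∪ ⁅ u ⁆) (S′ ∪ ⁅ u ⁆)
                         (trans (sym (F-∉ S u∉S)) (trans eq (F-∉ S′ u∉S′)))) ⟩
  S′ ∪ ⁅ u ⁆ - u    ≡⟨ x∉p⇒p∪⁅x⁆-x≡p u∉S′ ⟩
  S′                ∎
  where open ≡-Reasoning

F-surjectiveˡ : ∀ {j} (G : Subset (suc j)) t → t ∈ G → ∃[ S ] F S t ≡ G
F-surjectiveˡ G t t∈G with initLast G
... | S , inside  , refl = S , F-∈ S t∈G
... | S , outside , refl with view t
-- Here `j` is not in `G`, so `t ∈ G` excludes `t = j`; deleting `t` from the first `j` entries then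
-- gives the preimage.
...   | ‵fromℕ     = contradiction t∈G (fromℕ∉widen S)
...   | ‵inject₁ u = S - u ,
  trans (F-∉ (S - u) (x∉p-x S u)) (cong widen (x∈p⇒[p-x]∪⁅x⁆≡p (inject₁-∈⁻ S u outside t∈G)))

KSubset-≡ : ∀ {N k} {A B : KSubset N k} → proj₁ A ≡ proj₁ B → A ≡ B
KSubset-≡ {A = _ , p} {B = _ , q} refl = cong (_ ,_) (≡-irrelevant p q)

-- At `suc r` the truncated `suc r ∸ 1` reduces to `r`, which matches the one element that `F` adds.
-- At 0 it would stay 0 and the size claim would fail.
wellDefined : ∀ j r → WellDefined j (suc r)
wellDefined j r (S , ∣S∣≡r) t = ∣F∣≡1+r , subst (rank (F S t) t <_) ∣F∣≡1+r (rank<∣A∣ (t∈F S t))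
  where
  ∣F∣≡1+r : ∣ F S t ∣ ≡ suc r
  ∣F∣≡1+r = trans (∣F∣≡1+∣S∣ S t) (cong suc ∣S∣≡r)

Φ-injective : ∀ {j r} (wd : WellDefined j r) → Injective _≡_ _≡_ (Φ {j} {r} wd)
Φ-injective wd {S , t} {S′ , t′} eq = cong₂ _,_ (KSubset-≡ S≡S′) t≡t′
  where
  F≡ : F (proj₁ S) t ≡ F (proj₁ S′) t′
  F≡ = cong (proj₁ ∘ proj₁) eq

  -- Both ranks must be taken in the same set before injectivity of rank applies, so `t′` is moved
  -- into `F (proj₁ S) t` along `F≡`.
  rank≡ : rank (F (proj₁ S) t) t ≡ rank (F (proj₁ S) t) t′
  rank≡ = trans
    (fromℕ<-injective _ _ (proj₂ (wd S t)) (proj₂ (wd S′ t′)) (cong proj₂ eq))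
    (cong (λ G → rank G t′) (sym F≡))

  t≡t′ : t ≡ t′
  t≡t′ = rank-injective (t∈F (proj₁ S) t) (subst (t′ ∈_) (sym F≡) (t∈F (proj₁ S′) t′)) rank≡

  -- `F` is injective in `S` only for a fixed `t`, so `t ≡ t′` has to come first.
  S≡S′ : proj₁ S ≡ proj₁ S′
  S≡S′ = F-injectiveˡ (proj₁ S) (proj₁ S′) t (trans F≡ (cong (F (proj₁ S′)) (sym t≡t′)))

Φ-strictlySurjective : ∀ {j r} (wd : WellDefined j (suc r)) → StrictlySurjective _≡_ (Φ {j} {suc r} wd)
Φ-strictlySurjective wd ((G , ∣G∣≡1+r) , i)
  -- `t` is chosen as the element of `G` of rank `i`; only then is `S` recovered from `G` and `t`.
  with t , t∈G , rank≡i ← rank-surjective G (subst (toℕ i <_) (sym ∣G∣≡1+r) (toℕ<n i))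
  with S , refl ← F-surjectiveˡ G t t∈G
  = ((S , ∣S∣≡r) , t) ,
    cong₂ _,_ (KSubset-≡ refl)
      (toℕ-injective (trans (toℕ-fromℕ< (proj₂ (wd (S , ∣S∣≡r) t))) rank≡i))
  where
  -- The recovered `S` carries no size, so it is read off from the size of `G`, which is now
  -- `F S t`.
  ∣S∣≡r = suc-injective (trans (sym (∣F∣≡1+∣S∣ S t)) ∣G∣≡1+r)

theorem3 : (m n : ℕ) → m ≤ n →
    let k = m ⊓ (n ∸ m) in
    (r : ℕ) → 1 ≤ r → r ≤ k →
    let j = (n ∸ k) + r ∸ 1 in
    Σ[ wd ∈ WellDefined j r ] Bijective _≡_ _≡_ (Φ {j} {r} wd)
-- `1 ≤ r` rules out zero, leaving the successor form used above.
theorem3 m n _ (suc r) _ _ =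
  wd , Φ-injective wd , strictlySurjective⇒surjective (Φ-strictlySurjective wd)
  where
  wd = wellDefined ((n ∸ m ⊓ (n ∸ m)) + suc r ∸ 1) r
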